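{- Let $G$ be a fixed edge-ordered graph with minimal edge $e_0$ and maximal edge $e_{\max}$. If $e_0$ and $e_{\max}$ are both isolated in $G$, then $ssat_e(n,G)=O(1)$; otherwise $ssat_e(n,G)=\Omega(n)$.
   Context: An edge-ordered graph is a finite simple graph together with a linear order on its edge set (usually given by an injective labeling $l:E\to\mathbb{N}$ or $l:E\to\mathbb{R}$). A copy of $G$ in an edge-ordered graph $H$ is a subgraph of $H$ (with the induced edge-order) isomorphic to $G$ by an isomorphism respecting the edge-order. The minimal (maximal) edge is the edge with the smallest (largest) label; an edge is isolated if it shares no vertex with any other edge. $ssat_e(n,G)$ is the minimum number of edges in an edge-ordered graph $H$ on $n$ vertices (not required to be $G$-free) such that adding to $H$ any missing edge, inserted at an arbitrary position of the linear order of the edges, creates a new copy of $G$ (one using the added edge); that is, for every missing edge and every position a new copy is created. Asymptotic notation is for $n\to\infty$ with $G$ fixed ($n$ is assumed large enough). -}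

module Defs where

open import Data.Fin as Fin using (Fin; zero; suc)
import Data.Fin.Properties as Fin
open import Data.Fin.Subset using (Subset) renaming (_∈_ to _∈ₛ_)
open import Data.Fin.Subset.Properties using (anySubset?) renaming (_∈?_ to _∈ₛ?_)
open import Data.List as List using (List)
import Data.List.Membership.Propositional as List
import Data.List.Membership.Propositional.Properties as List
import Data.List.Relation.Unary.All as ListAll
import Data.List.Relation.Unary.AllPairs as ListAllPairs
import Data.List.Relation.Unary.Any as ListAny
import Data.List.Relation.Unary.Unique.DecPropositional.Properties as ListUnique
open import Data.Nat as ℕ using (ℕ; zero; suc; _*_; _≤_; _≥_; z≤n; s≤s)
import Data.Nat.Properties as ℕ
open import Data.Product using (Σ; ∃; ∃₂; ∃-syntax; _×_; _,_; proj₁; proj₂)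
open import Data.Sum using (_⊎_; inj₁; inj₂)
open import Data.Vec as Vec using (Vec; []; _∷_; lookup; insertAt; tabulate; fromList)
import Data.Vec.Membership.Propositional as Vec
import Data.Vec.Membership.Propositional.Properties as Vec
open import Data.Vec.Membership.Propositional using (_∉_)
open import Data.Vec.Properties using (lookup∘tabulate)
open import Data.Vec.Relation.Unary.All using (All; []; _∷_)
import Data.Vec.Relation.Unary.All.Properties as All
open import Data.Vec.Relation.Unary.AllPairs using ([]; _∷_; allPairs?)
import Data.Vec.Relation.Unary.Any as Any
open import Data.Vec.Relation.Unary.Unique.Propositional using (Unique)
open import Function using (_∘_; _⇔_; mk⇔; Equivalence; Injective)
open import Relation.Binary using (DecidableEquality)
open import Relation.Binary.PropositionalEquality
  using (_≡_; _≢_; _≗_; refl; sym; trans; cong)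
open import Relation.Nullary using (¬_; Dec; yes; no; contradiction)
open import Relation.Nullary.Decidable using (map′; _×-dec_; _⊎-dec_; _→-dec_; ¬?)
open import Relation.Unary using (Decidable)

private
  variable
    k l m n : ℕ

-- The unordered pair {lo , hi} of distinct vertices, each pair having exactly
-- one representation.
record Edge (n : ℕ) : Set where
  constructor mkEdge
  field
    lo hi : Fin n
    lo<hi : lo Fin.< hi

open Edge public

infix 4 _∈ₑ_

_∈ₑ_ : Fin n → Edge n → Set
v ∈ₑ e = v ≡ lo e ⊎ v ≡ hi e

-- A simple graph with vertex set Fin n and m edges, with a linear order on the
-- edges: the edges are listed in increasing order, without repetition.  An edge
-- is referred to by its position i : Fin m, so that the order on the edges is
-- the order of Fin m.
record EdgeOrderedGraph (n m : ℕ) : Set where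
  constructor mkGraph
  field
    edges  : Vec (Edge n) m
    unique : Unique edges

  edge : Fin m → Edge n
  edge = lookup edges

open EdgeOrderedGraph public

Minimal : EdgeOrderedGraph n m → Fin m → Set
Minimal {m = m} _ e = (f : Fin m) → e Fin.≤ f

Maximal : EdgeOrderedGraph n m → Fin m → Set
Maximal {m = m} _ e = (f : Fin m) → f Fin.≤ e

Isolated : EdgeOrderedGraph n m → Fin m → Set
Isolated G e = ∀ f → f ≢ e → ∀ v → v ∈ₑ edge G e → ¬ v ∈ₑ edge G f

-- The edges of a subgraph carry the induced order, i.e. that of Fin m.
record Subgraph (H : EdgeOrderedGraph n m) : Set where
  constructor mkSubgraph
  field
    vertexSet : Subset n
    edgeSet   : Subset m
    closed    : ∀ i → i ∈ₛ edgeSet → ∀ v → v ∈ₑ edge H i → v ∈ₛ vertexSet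

open Subgraph public

-- Injectivity of the edge map ψ follows from ψ-order.
record IsIsomorphism (G : EdgeOrderedGraph k l) {H : EdgeOrderedGraph n m} (S : Subgraph H)
                     (φ : Fin k → Fin n) (ψ : Fin l → Fin m) : Set where
  field
    φ-injective : Injective _≡_ _≡_ φ
    φ-image     : ∀ v → v ∈ₛ vertexSet S ⇔ (∃[ u ] φ u ≡ v)
    ψ-image     : ∀ j → j ∈ₛ edgeSet S ⇔ (∃[ i ] ψ i ≡ j)
    incidence   : ∀ u i → u ∈ₑ edge G i ⇔ φ u ∈ₑ edge H (ψ i)
    ψ-order     : ∀ i j → i Fin.< j ⇔ ψ i Fin.< ψ j

infix 4 _≅_

_≅_ : EdgeOrderedGraph k l → {H : EdgeOrderedGraph n m} → Subgraph H → Set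
G ≅ S = ∃₂ (IsIsomorphism G S)

CopyUsing : EdgeOrderedGraph k l → (H : EdgeOrderedGraph n m) → Fin m → Set
CopyUsing G H e = Σ (Subgraph H) λ S → G ≅ S × e ∈ₛ edgeSet S

private
  ∉⇒All : ∀ {A : Set} {x : A} {xs : Vec A m} → x ∉ xs → All (x ≢_) xs
  ∉⇒All {xs = []}     _    = []
  ∉⇒All {xs = _ ∷ _} x∉ = x∉ ∘ Any.here ∷ ∉⇒All (x∉ ∘ Any.there)

  All-insertAt : ∀ {A : Set} {P : A → Set} {x} {xs : Vec A m} →
                 All P xs → P x → ∀ p → All P (insertAt xs p x)
  All-insertAt pxs        px zero    = px ∷ pxs
  All-insertAt (py ∷ pxs) px (suc p) = py ∷ All-insertAt pxs px p

insertAt-unique : ∀ {A : Set} {x : A} {xs : Vec A m} →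
                  Unique xs → x ∉ xs → ∀ p → Unique (insertAt xs p x)
insertAt-unique u        x∉ zero    = ∉⇒All x∉ ∷ u
insertAt-unique (a ∷ u) x∉ (suc p) =
  All-insertAt a (x∉ ∘ Any.here ∘ sym) p ∷ insertAt-unique u (x∉ ∘ Any.there) p

-- The new edge is at position p of the resulting graph.
addEdge : (H : EdgeOrderedGraph n m) (e : Edge n) → e ∉ edges H → Fin (suc m) →
          EdgeOrderedGraph n (suc m)
addEdge H e e∉ p = mkGraph (insertAt (edges H) p e) (insertAt-unique (unique H) e∉ p)

Semisaturated : EdgeOrderedGraph k l → EdgeOrderedGraph n m → Set
Semisaturated G H = ∀ e (e∉ : e ∉ edges H) p → CopyUsing G (addEdge H e e∉ p) p

SemisaturatedSize : EdgeOrderedGraph k l → ℕ → ℕ → Set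
SemisaturatedSize G n m = Σ (EdgeOrderedGraph n m) (Semisaturated G)

IsMinimum : (ℕ → Set) → ℕ → Set
IsMinimum P m = P m × (∀ m′ → P m′ → m ≤ m′)

-- The minimum exists: semisaturation is decidable, and complete graphs are
-- semisaturated.

private
  ⇔-dec : ∀ {A B : Set} → Dec A → Dec B → Dec (A ⇔ B)
  ⇔-dec a? b? = map′ (λ (f , g) → mk⇔ f g) (λ e → Equivalence.to e , Equivalence.from e)
                     ((a? →-dec b?) ×-dec (b? →-dec a?))

  _∈ₑ?_ : (v : Fin n) (e : Edge n) → Dec (v ∈ₑ e)
  v ∈ₑ? e = v Fin.≟ lo e ⊎-dec v Fin.≟ hi e

  _≟ₑ_ : DecidableEquality (Edge n)
  mkEdge a b p ≟ₑ mkEdge c d q = map′ to (λ { refl → refl , refl }) (a Fin.≟ c ×-dec b Fin.≟ d)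
    where
    to : a ≡ c × b ≡ d → mkEdge a b p ≡ mkEdge c d q
    to (refl , refl) = cong (mkEdge a b) (ℕ.≤-irrelevant p q)

  mkEdges : (a b : Fin n) → List (Edge n)
  mkEdges a b with a Fin.<? b
  ... | yes a<b = List.[ mkEdge a b a<b ]
  ... | no  _   = List.[]

  ∈-mkEdges : (e : Edge n) → e List.∈ mkEdges (lo e) (hi e)
  ∈-mkEdges (mkEdge a b p) with a Fin.<? b
  ... | yes q = ListAny.here (cong (mkEdge a b) (ℕ.≤-irrelevant p q))
  ... | no ¬q = contradiction p ¬q

  allEdges : ∀ n → List (Edge n)
  allEdges n = List.concatMap (λ a → List.concatMap (mkEdges a) (List.allFin n)) (List.allFin n)

  ∈-allEdges : (e : Edge n) → e List.∈ allEdges n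
  ∈-allEdges e =
    List.∈-concatMap⁺ (λ a → List.concatMap (mkEdges a) (List.allFin _))
      (List.lose (List.∈-allFin (lo e))
        (List.∈-concatMap⁺ (mkEdges (lo e)) (List.lose (List.∈-allFin (hi e)) (∈-mkEdges e))))

  Searchable : Set → Set₁
  Searchable A = ∀ {P : A → Set} → Decidable P → Dec (∃ P)

  searchEdge : Searchable (Edge n)
  searchEdge P? = map′ ListAny.satisfied (λ (e , pe) → List.lose (∈-allEdges e) pe)
                       (ListAny.any? P? (allEdges _))

  searchVec : ∀ {A : Set} → Searchable A → ∀ m → Searchable (Vec A m)
  searchVec s zero    P? = map′ ([] ,_) (λ { ([] , p) → p }) (P? [])
  searchVec s (suc m) P? =
    map′ (λ (x , xs , p) → x ∷ xs , p) (λ { (x ∷ xs , p) → x , xs , p })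
         (s λ x → searchVec s m λ xs → P? (x ∷ xs))

  searchFun : {P : (Fin m → Fin n) → Set} → (∀ {f g} → f ≗ g → P f → P g) →
              Decidable P → Dec (∃ P)
  searchFun resp P? =
    map′ (λ (v , p) → lookup v , p)
         (λ (f , p) → tabulate f , resp (sym ∘ lookup∘tabulate f) p)
         (searchVec Fin.any? _ (P? ∘ lookup))

  all-Edge? : {P : Edge n → Set} → Decidable P → Dec (∀ e → P e)
  all-Edge? P? = map′ (λ ps e → ListAll.lookup ps (∈-allEdges e)) (λ f → ListAll.tabulate λ {e} _ → f e)
                      (ListAll.all? P? (allEdges _))

  module _ (G : EdgeOrderedGraph k l) {H : EdgeOrderedGraph n m} where

    isIsomorphism? : (S : Subgraph H) → ∀ φ ψ → Dec (IsIsomorphism G S φ ψ)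
    isIsomorphism? S φ ψ =
      map′ (λ (a , b , c , d , e) → record
             { φ-injective = λ {x} {y} → a x y ; φ-image = b ; ψ-image = c
             ; incidence = d ; ψ-order = e })
           (λ iso → let open IsIsomorphism iso in
             (λ x y → φ-injective {x} {y}) , φ-image , ψ-image , incidence , ψ-order)
           (Fin.all? (λ x → Fin.all? λ y → φ x Fin.≟ φ y →-dec x Fin.≟ y)
            ×-dec Fin.all? (λ v → ⇔-dec (v ∈ₛ? vertexSet S) (Fin.any? λ u → φ u Fin.≟ v))
            ×-dec Fin.all? (λ j → ⇔-dec (j ∈ₛ? edgeSet S) (Fin.any? λ i → ψ i Fin.≟ j))
            ×-dec Fin.all? (λ u → Fin.all? λ i → ⇔-dec (u ∈ₑ? edge G i) (φ u ∈ₑ? edge H (ψ i)))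
            ×-dec Fin.all? (λ i → Fin.all? λ j → ⇔-dec (i Fin.<? j) (ψ i Fin.<? ψ j)))

    ≗-resp : ∀ {S : Subgraph H} {φ φ′ ψ ψ′} → φ ≗ φ′ → ψ ≗ ψ′ →
             IsIsomorphism G S φ ψ → IsIsomorphism G S φ′ ψ′
    ≗-resp {S} {φ} {φ′} {ψ} {ψ′} p q iso = record
      { φ-injective = λ {x} {y} eq → φ-injective (trans (p x) (trans eq (sym (p y))))
      ; φ-image     = λ v → image p (φ-image v)
      ; ψ-image     = λ j → image q (ψ-image j)
      ; incidence   = inc
      ; ψ-order     = ord
      }
      where
      open IsIsomorphism iso
      image : ∀ {a b} {f f′ : Fin a → Fin b} {y} {A : Set} → f ≗ f′ →
              A ⇔ (∃[ x ] f x ≡ y) → A ⇔ (∃[ x ] f′ x ≡ y)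
      image r e = mk⇔ (λ a → let x , eq = Equivalence.to e a in x , trans (sym (r x)) eq)
                      (λ (x , eq) → Equivalence.from e (x , trans (r x) eq))
      inc : ∀ u i → u ∈ₑ edge G i ⇔ φ′ u ∈ₑ edge H (ψ′ i)
      inc u i rewrite sym (p u) | sym (q i) = incidence u i
      ord : ∀ i j → i Fin.< j ⇔ ψ′ i Fin.< ψ′ j
      ord i j rewrite sym (q i) | sym (q j) = ψ-order i j

    _≅?_ : (S : Subgraph H) → Dec (G ≅ S)
    _≅?_ S = searchFun (λ p (ψ , iso) → ψ , ≗-resp p (λ _ → refl) iso)
               λ φ → searchFun (≗-resp (λ _ → refl)) (isIsomorphism? S φ)

  copyUsing? : (G : EdgeOrderedGraph k l) (H : EdgeOrderedGraph n m) (e : Fin m) →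
               Dec (CopyUsing G H e)
  copyUsing? {n = n} {m = m} G H e =
    map′ (λ (V , E , cl , rest) → mkSubgraph V E cl , rest)
         (λ (mkSubgraph V E cl , rest) → V , E , cl , rest)
         (anySubset? λ V → anySubset? λ E → decide V E)
    where
    Closed : Subset n → Subset m → Set
    Closed V E = ∀ i → i ∈ₛ E → ∀ v → v ∈ₑ edge H i → v ∈ₛ V

    closed? : ∀ V E → Dec (Closed V E)
    closed? V E = Fin.all? λ i → i ∈ₛ? E →-dec
                  Fin.all? λ v → v ∈ₑ? edge H i →-dec v ∈ₛ? V

    decide : ∀ V E → Dec (Σ (Closed V E) λ cl → (G ≅ mkSubgraph {H = H} V E cl) × e ∈ₛ E)
    decide V E with closed? V E
    ... | no ¬cl = no (¬cl ∘ proj₁)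
    ... | yes cl = map′ (cl ,_) (λ (cl′ , (φ , ψ , iso) , e∈) →
                          (φ , ψ , record { IsIsomorphism iso }) , e∈)
                        (_≅?_ G (mkSubgraph V E cl) ×-dec e ∈ₛ? E)

  -- Copies depend on the list of edges only, not on the proof of uniqueness.
  copyUsing-resp : {G : EdgeOrderedGraph k l} {H H′ : EdgeOrderedGraph n m} {e : Fin m} →
                   edges H ≡ edges H′ → CopyUsing G H e → CopyUsing G H′ e
  copyUsing-resp refl (mkSubgraph V E cl , (φ , ψ , iso) , e∈) =
    mkSubgraph V E cl , (φ , ψ , record { IsIsomorphism iso }) , e∈

  semisaturated? : (G : EdgeOrderedGraph k l) (H : EdgeOrderedGraph n m) → Dec (Semisaturated G H)
  semisaturated? G H = all-Edge? decide
    where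
    decide : ∀ e → Dec (∀ (e∉ : e ∉ edges H) p → CopyUsing G (addEdge H e e∉ p) p)
    decide e with Any.any? (e ≟ₑ_) (edges H)
    ... | yes e∈ = yes λ e∉ → contradiction e∈ e∉
    ... | no  e∉ = map′ (λ f e∉′ p → copyUsing-resp refl (f p)) (λ f → f e∉)
                        (Fin.all? λ p → copyUsing? G (addEdge H e e∉ p) p)

  semisaturatedSize? : (G : EdgeOrderedGraph k l) → ∀ n m → Dec (SemisaturatedSize G n m)
  semisaturatedSize? G n m =
    map′ (λ (es , u , sat) → mkGraph es u , sat) (λ (mkGraph es u , sat) → es , u , sat)
         (searchVec searchEdge m decide)
    where
    decide : ∀ es → Dec (Σ (Unique es) λ u → Semisaturated G (mkGraph {n} es u))
    decide es with allPairs? (λ e f → ¬? (e ≟ₑ f)) es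
    ... | no ¬u = no (¬u ∘ proj₁)
    ... | yes u = map′ (u ,_) (λ (_ , sat) e e∉ p → copyUsing-resp refl (sat e e∉ p))
                       (semisaturated? G (mkGraph es u))

  completeSize : ∀ n → ∃[ m ] Σ (EdgeOrderedGraph n m) λ K → ∀ e → e Vec.∈ edges K
  completeSize n = _ , mkGraph (fromList es) (unique-fromList (ListUnique.deduplicate-! _≟ₑ_ (allEdges n)))
                     , λ e → Vec.∈-fromList⁺ (List.∈-deduplicate⁺ _≟ₑ_ (∈-allEdges e))
    where
    es : List (Edge n)
    es = List.deduplicate _≟ₑ_ (allEdges n)
    unique-fromList : ∀ {xs : List (Edge n)} → ListAllPairs.AllPairs _≢_ xs → Unique (fromList xs)
    unique-fromList ListAllPairs.[]       = []
    unique-fromList (a ListAllPairs.∷ u) = All.fromList⁺ a ∷ unique-fromList u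

  minimum : {P : ℕ → Set} → Decidable P → ∀ {m} → P m → ∃ (IsMinimum P)
  minimum {P} P? {zero} p = 0 , p , λ _ _ → z≤n
  minimum {P} P? {suc m} p with P? 0
  ... | yes p₀ = 0 , p₀ , λ _ _ → z≤n
  ... | no ¬p₀ with minimum (P? ∘ suc) p
  ...   | m₀ , p′ , least = suc m₀ , p′ , λ where
            zero     q → contradiction q ¬p₀
            (suc m′) q → s≤s (least m′ q)

abstract
  minimum-exists : (G : EdgeOrderedGraph k l) → ∀ n → ∃ (IsMinimum (SemisaturatedSize G n))
  minimum-exists G n with completeSize n
  ... | _ , K , complete =
    minimum (semisaturatedSize? G n) (K , λ e e∉ → contradiction (complete e) e∉)

ssatₑ : ℕ → EdgeOrderedGraph k l → ℕ
ssatₑ n G = proj₁ (minimum-exists G n)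

ssatₑ-isMinimum : (G : EdgeOrderedGraph k l) → ∀ n → IsMinimum (SemisaturatedSize G n) (ssatₑ n G)
ssatₑ-isMinimum G n = proj₂ (minimum-exists G n)

-- f n ≤ C · g n for all large n; a real constant C may be rounded up.
_∈O[_] : (ℕ → ℕ) → (ℕ → ℕ) → Set
f ∈O[ g ] = ∃[ C ] ∃[ n₀ ] (∀ n → n ≥ n₀ → f n ≤ C * g n)

-- f n ≥ c · g n for all large n, with c = 1 / suc k; any real c > 0 may be
-- decreased to a constant of this form.
_∈Ω[_] : (ℕ → ℕ) → (ℕ → ℕ) → Set
f ∈Ω[ g ] = ∃[ k ] ∃[ n₀ ] (∀ n → n ≥ n₀ → g n ≤ suc k * f n)

{-# OPTIONS --safe #-}

-- Lower bound: an edge joining two vertices of H that lie on no edge is isolated in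
-- the new graph, and is its minimal or its maximal edge when added at the start or at
-- the end of the order; in a copy of G it then plays e₀ or eₘₐₓ, which must therefore
-- be isolated in G.  If they are not both isolated, the m edges of H thus cover all
-- vertices but at most one, and n ≤ 1 + 2m.
--
-- Upper bound: let H consist of seven disjoint copies of G, each preceding the next in
-- the edge order, and of isolated vertices.  If a new edge precedes a copy that it does
-- not meet, it can replace e₀ in that copy, e₀ being isolated; if it follows the copy,
-- it can replace eₘₐₓ.

module Submission where

open import Defs
open import Data.Bool.Properties using (T-≡)
open import Data.Fin as Fin
  using (Fin; zero; suc; toℕ; fromℕ; combine; remQuot; inject≤; punchIn; punchOut; _↑ˡ_; _↑ʳ_; #_)
open import Data.Fin.Properties
open import Data.Fin.Subset using (Subset) renaming (_∈_ to _∈ₛ_)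
open import Data.Nat as ℕ using (ℕ; suc; s≤s; s<s; z<s; _*_)
import Data.Nat.Properties as ℕ
open import Data.Product using (∃₂; ∃-syntax; _×_; _,_; proj₁; proj₂)
open import Data.Sum using (inj₁; inj₂; [_,_]′)
open import Data.Vec using (insertAt; lookup; tabulate)
open import Data.Vec.Membership.Propositional using (_∉_)
open import Data.Vec.Properties
  using (lookup∘tabulate; []=⇒lookup; lookup⇒[]=; insertAt-lookup; insertAt-punchIn)
import Data.Vec.Relation.Unary.Any as Any
import Data.Vec.Relation.Unary.Any.Properties as Any
open import Data.Vec.Relation.Unary.Unique.Propositional.Properties using (tabulate⁺; lookup-injective)
open import Function using (_∘_; _⇔_; mk⇔; Equivalence; Injective)
open import Relation.Binary using (tri<; tri≈; tri>)
open import Relation.Binary.PropositionalEquality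
  using (_≡_; _≢_; refl; sym; trans; cong; cong₂; subst; subst₂)
open import Relation.Nullary using (¬_; Dec; yes; no; contradiction)
open import Relation.Nullary.Decidable using (⌊_⌋; toWitness; fromWitness)

private
  variable
    k l m n : ℕ

-- Endpoints of edges, and the order on positions.

Edge-≡ : {e f : Edge n} → lo e ≡ lo f → hi e ≡ hi f → e ≡ f
Edge-≡ {e = mkEdge a b _} refl refl = cong (mkEdge a b) (ℕ.≤-irrelevant _ _)

-- Indexing the two ends by `Fin 2` lets them be searched by `any?` and counted by the pigeonhole
-- principle.
endpoint : Edge n → Fin 2 → Fin n
endpoint e zero    = lo e
endpoint e (suc _) = hi e

∈ₑ⇒endpoint : {v : Fin n} {e : Edge n} → v ∈ₑ e → ∃[ s ] endpoint e s ≡ v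
∈ₑ⇒endpoint (inj₁ eq) = # 0 , sym eq
∈ₑ⇒endpoint (inj₂ eq) = # 1 , sym eq

punchIn-mono-< : ∀ p {i j : Fin m} → i Fin.< j → punchIn p i Fin.< punchIn p j
punchIn-mono-< p {i} {j} i<j = ℕ.≰⇒> λ ≥ → ℕ.<⇒≱ i<j (punchIn-cancel-≤ p j i ≥)

punchIn-< : ∀ (p : Fin (suc m)) i → i Fin.< p → punchIn p i Fin.< p
punchIn-< (suc p) zero    _       = z<s
punchIn-< (suc p) (suc i) (s<s <) = s<s (punchIn-< p i <)

punchIn-> : ∀ (p : Fin (suc m)) i → p Fin.≤ i → p Fin.< punchIn p i
punchIn-> zero    i       _       = z<s
punchIn-> (suc p) (suc i) (s≤s ≤) = s<s (punchIn-> p i ≤)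

combine-monoʳ-< : ∀ (b : Fin m) {i j : Fin n} → i Fin.< j → combine b i Fin.< combine b j
combine-monoʳ-< {n = n} b {i} {j} i<j
  rewrite toℕ-combine b i | toℕ-combine b j = ℕ.+-monoʳ-< (n * toℕ b) i<j

-- The linear lower bound

Covered : EdgeOrderedGraph n m → Fin n → Set
Covered H v = ∃₂ λ s i → endpoint (edge H i) s ≡ v

covered? : (H : EdgeOrderedGraph n m) (v : Fin n) → Dec (Covered H v)
covered? H v = any? λ s → any? λ i → endpoint (edge H i) s ≟ v

∈ₑ⇒covered : (H : EdgeOrderedGraph n m) {v : Fin n} (i : Fin m) → v ∈ₑ edge H i → Covered H v
∈ₑ⇒covered H i v∈ with s , eq ← ∈ₑ⇒endpoint v∈ = s , i , eq

-- Pigeonhole with 1 + 2m codes: a covered vertex gets the nonzero code of an edge end equal to it,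
-- and all uncovered vertices share the code `zero`. A nonzero code determines its vertex, so two
-- distinct vertices can only collide at `zero`.
uncovered-pair : (H : EdgeOrderedGraph n m) → suc (2 * m) ℕ.< n →
                 ∃₂ λ u v → u Fin.< v × ¬ Covered H u × ¬ Covered H v
uncovered-pair {n = n} {m = m} H large =
  let u , v , u<v , eq = pigeonhole large code in u , v , u<v , code-injective u v u<v eq
  where
  code : Fin n → Fin (suc (2 * m))
  code v with covered? H v
  ... | yes (s , i , _) = suc (combine s i)
  ... | no  _           = zero

  code-injective : ∀ u v → u Fin.< v → code u ≡ code v → ¬ Covered H u × ¬ Covered H v
  code-injective u v u<v eq with covered? H u | covered? H v
  ... | no ¬u | no ¬v = ¬u , ¬v
  ... | yes (s , i , su) | yes (t , j , tv)
    with refl , refl ← combine-injective s i t j (suc-injective eq)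
    = contradiction (trans (sym su) tv) (<⇒≢ u<v)

-- Every position other than `p` holds an old edge, found by `punchOut`, and all ends of old edges
-- are covered.
addEdge-isolated : (H : EdgeOrderedGraph n m) (e : Edge n) (e∉ : e ∉ edges H) (p : Fin (suc m)) →
                   (∀ v → v ∈ₑ e → ¬ Covered H v) → Isolated (addEdge H e e∉ p) p
addEdge-isolated H e e∉ p uncovered f f≢p v v∈p v∈f =
  uncovered v (subst (v ∈ₑ_) (insertAt-lookup (edges H) p e) v∈p)
    (∈ₑ⇒covered H j (subst (v ∈ₑ_) edge-f v∈f))
  where
  j = punchOut (f≢p ∘ sym)
  edge-f : lookup (insertAt (edges H) p e) f ≡ edge H j
  edge-f = trans (cong (lookup (insertAt (edges H) p e)) (sym (punchIn-punchOut (f≢p ∘ sym))))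
                 (insertAt-punchIn (edges H) p e j)

module _ {G : EdgeOrderedGraph k l} {H : EdgeOrderedGraph n m} {S : Subgraph H}
         {φ : Fin k → Fin n} {ψ : Fin l → Fin m} (iso : IsIsomorphism G S φ ψ) where
  open IsIsomorphism iso

  -- A vertex shared by two edges of `G` is mapped to a vertex shared by their images, which are
  -- distinct because `ψ` is strictly monotone.
  isolated-reflect : ∀ i → Isolated H (ψ i) → Isolated G i
  isolated-reflect i isolated f f≢i v v∈i v∈f =
    isolated (ψ f) ψf≢ψi (φ v) (Equivalence.to (incidence v i) v∈i) (Equivalence.to (incidence v f) v∈f)
    where
    ψf≢ψi : ψ f ≢ ψ i
    ψf≢ψi eq with <-cmp f i
    ... | tri< f<i _ _ = <⇒≢ (Equivalence.to (ψ-order f i) f<i) eq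
    ... | tri≈ _ f≡i _ = f≢i f≡i
    ... | tri> _ _ i<f = <⇒≢ (Equivalence.to (ψ-order i f) i<f) (sym eq)

  minimal-reflect : ∀ i → Minimal H (ψ i) → Minimal G i
  minimal-reflect i min f = ℕ.≮⇒≥ λ f<i → ℕ.<⇒≱ (Equivalence.to (ψ-order f i) f<i) (min (ψ f))

  maximal-reflect : ∀ i → Maximal H (ψ i) → Maximal G i
  maximal-reflect i max f = ℕ.≮⇒≥ λ i<f → ℕ.<⇒≱ (Equivalence.to (ψ-order i f) i<f) (max (ψ f))

-- The edge of `G` that is mapped to `p` is isolated and minimal in `G`, since both properties
-- reflect along the isomorphism; by antisymmetry it is `e`.
copyUsing-minimal : {G : EdgeOrderedGraph k l} {H : EdgeOrderedGraph n m} {e : Fin l} {p : Fin m} →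
                    Minimal G e → Minimal H p → Isolated H p → CopyUsing G H p → Isolated G e
copyUsing-minimal {G = G} {e = e} minG minH isolated (S , (φ , ψ , iso) , p∈)
  with i , refl ← Equivalence.to (IsIsomorphism.ψ-image iso _) p∈
  = subst (Isolated G) (≤-antisym (minimal-reflect iso i minH e) (minG i))
      (isolated-reflect iso i isolated)

copyUsing-maximal : {G : EdgeOrderedGraph k l} {H : EdgeOrderedGraph n m} {e : Fin l} {p : Fin m} →
                    Maximal G e → Maximal H p → Isolated H p → CopyUsing G H p → Isolated G e
copyUsing-maximal {G = G} {e = e} maxG maxH isolated (S , (φ , ψ , iso) , p∈)
  with i , refl ← Equivalence.to (IsIsomorphism.ψ-image iso _) p∈
  = subst (Isolated G) (≤-antisym (maxG i) (maximal-reflect iso i maxH e))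
      (isolated-reflect iso i isolated)

semisaturated⇒large : {G : EdgeOrderedGraph k l} {e₀ eₘₐₓ : Fin l} → Minimal G e₀ → Maximal G eₘₐₓ →
                      ¬ (Isolated G e₀ × Isolated G eₘₐₓ) →
                      (H : EdgeOrderedGraph n m) → Semisaturated G H → n ℕ.≤ suc (2 * m)
semisaturated⇒large {m = m} {G = G} {e₀} {eₘₐₓ} min max ¬isolated H saturated =
  ℕ.≮⇒≥ λ large → ¬isolated (both (uncovered-pair H large))
  where
  both : (∃₂ λ u v → u Fin.< v × ¬ Covered H u × ¬ Covered H v) → Isolated G e₀ × Isolated G eₘₐₓ
  both (u , v , u<v , ¬u , ¬v) =
    -- The same new edge is inserted at each end of the order, so no case distinction on which of
    -- the two edges fails to be isolated is made.
    copyUsing-minimal min (λ _ → ℕ.z≤n) (isolated zero) (saturated e e∉ zero) ,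
    copyUsing-maximal max ≤fromℕ (isolated (fromℕ m)) (saturated e e∉ (fromℕ m))
    where
    e : Edge _
    e = mkEdge u v u<v
    e∉ : e ∉ edges H
    e∉ e∈ = ¬u (∈ₑ⇒covered H (Any.index e∈) (inj₁ (cong lo (Any.lookup-index e∈))))
    isolated : ∀ p → Isolated (addEdge H e e∉ p) p
    isolated p = addEdge-isolated H e e∉ p
      λ w w∈ → [ (λ { refl → ¬u }) , (λ { refl → ¬v }) ]′ w∈

-- The constant upper bound

-- Asking `φ` to send `lo` to `lo` and `hi` to `hi` is stronger than preserving incidence, but all
-- copies built below satisfy it, and incidence in both directions then follows from injectivity.
record Embedding (G : EdgeOrderedGraph k l) (H : EdgeOrderedGraph n m) : Set where
  field
    φ           : Fin k → Fin n
    ψ           : Fin l → Fin m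
    φ-injective : Injective _≡_ _≡_ φ
    ψ-mono      : ∀ {i j} → i Fin.< j → ψ i Fin.< ψ j
    lo-≡        : ∀ i → lo (edge H (ψ i)) ≡ φ (lo (edge G i))
    hi-≡        : ∀ i → hi (edge H (ψ i)) ≡ φ (hi (edge G i))

image : (Fin m → Fin n) → Subset n
image f = tabulate λ y → ⌊ any? (λ x → f x ≟ y) ⌋

∈-image : (f : Fin m → Fin n) (y : Fin n) → y ∈ₛ image f ⇔ (∃[ x ] f x ≡ y)
∈-image f y = mk⇔
  (λ y∈ → toWitness (Equivalence.from T-≡ (trans (sym (lookup∘tabulate _ y)) ([]=⇒lookup y∈))))
  (λ fx≡y → lookup⇒[]= y _ (trans (lookup∘tabulate _ y) (Equivalence.to T-≡ (fromWitness fx≡y))))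

embedding⇒copyUsing : {G : EdgeOrderedGraph k l} {H : EdgeOrderedGraph n m} (E : Embedding G H) →
                      ∀ i → CopyUsing G H (Embedding.ψ E i)
embedding⇒copyUsing {G = G} {H} E g =
  mkSubgraph (image φ) (image ψ) closed′ ,
  (φ , ψ , record
    { φ-injective = φ-injective
    ; φ-image     = ∈-image φ
    ; ψ-image     = ∈-image ψ
    ; incidence   = λ u i → mk⇔ (incidence⁺ u i) (incidence⁻ u i)
    ; ψ-order     = λ i j → mk⇔ ψ-mono (ψ-cancel i j)
    }) ,
  Equivalence.from (∈-image ψ (ψ g)) (g , refl)
  where
  open Embedding E

  closed′ : ∀ j → j ∈ₛ image ψ → ∀ v → v ∈ₑ edge H j → v ∈ₛ image φ
  closed′ j j∈ v v∈ with i , refl ← Equivalence.to (∈-image ψ j) j∈ with v∈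
  ... | inj₁ v≡ = Equivalence.from (∈-image φ v) (_ , sym (trans v≡ (lo-≡ i)))
  ... | inj₂ v≡ = Equivalence.from (∈-image φ v) (_ , sym (trans v≡ (hi-≡ i)))

  incidence⁺ : ∀ u i → u ∈ₑ edge G i → φ u ∈ₑ edge H (ψ i)
  incidence⁺ u i (inj₁ refl) = inj₁ (sym (lo-≡ i))
  incidence⁺ u i (inj₂ refl) = inj₂ (sym (hi-≡ i))

  incidence⁻ : ∀ u i → φ u ∈ₑ edge H (ψ i) → u ∈ₑ edge G i
  incidence⁻ u i (inj₁ eq) = inj₁ (φ-injective (trans eq (lo-≡ i)))
  incidence⁻ u i (inj₂ eq) = inj₂ (φ-injective (trans eq (hi-≡ i)))

  ψ-cancel : ∀ i j → ψ i Fin.< ψ j → i Fin.< j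
  ψ-cancel i j ψi<ψj with <-cmp i j
  ... | tri< i<j _ _ = i<j
  ... | tri≈ _ refl _ = contradiction ψi<ψj (ℕ.<-irrefl refl)
  ... | tri> _ _ j<i = contradiction ψi<ψj (ℕ.<-asym (ψ-mono j<i))

-- Replacing an isolated edge of a copy by the new edge.

redirect : (Fin k → Fin n) → Edge k → Edge n → Fin k → Fin n
redirect f g e u with u ≟ lo g | u ≟ hi g
... | yes _ | _     = lo e
... | no  _ | yes _ = hi e
... | no  _ | no  _ = f u

module _ (f : Fin k → Fin n) (g : Edge k) (e : Edge n) where

  redirect-lo : redirect f g e (lo g) ≡ lo e
  redirect-lo with lo g ≟ lo g
  ... | yes _ = refl
  ... | no ≢  = contradiction refl ≢

  redirect-hi : redirect f g e (hi g) ≡ hi e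
  redirect-hi with hi g ≟ lo g | hi g ≟ hi g
  ... | yes eq | _     = contradiction (sym eq) (<⇒≢ (lo<hi g))
  ... | no _   | yes _ = refl
  ... | no _   | no ≢  = contradiction refl ≢

  redirect-∉ : ∀ {u} → ¬ u ∈ₑ g → redirect f g e u ≡ f u
  redirect-∉ {u} u∉ with u ≟ lo g | u ≟ hi g
  ... | yes eq | _      = contradiction (inj₁ eq) u∉
  ... | no _   | yes eq = contradiction (inj₂ eq) u∉
  ... | no _   | no _   = refl

  -- The two ends of `e` are distinct, and `f` takes neither of them as a value, so only equal cases
  -- can collide.
  redirect-injective : Injective _≡_ _≡_ f → (∀ u → ¬ f u ∈ₑ e) → Injective _≡_ _≡_ (redirect f g e)
  redirect-injective f-inj avoids {u} {v} eq
    with u ≟ lo g | u ≟ hi g | v ≟ lo g | v ≟ hi g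
  ... | yes p | _     | yes q | _     = trans p (sym q)
  ... | yes _ | _     | no _  | yes _ = contradiction eq (<⇒≢ (lo<hi e))
  ... | yes _ | _     | no _  | no _  = contradiction (inj₁ (sym eq)) (avoids v)
  ... | no _  | yes _ | yes _ | _     = contradiction (sym eq) (<⇒≢ (lo<hi e))
  ... | no _  | yes p | no _  | yes q = trans p (sym q)
  ... | no _  | yes _ | no _  | no _  = contradiction (inj₂ (sym eq)) (avoids v)
  ... | no _  | no _  | yes _ | _     = contradiction (inj₁ eq) (avoids u)
  ... | no _  | no _  | no _  | yes _ = contradiction (inj₂ eq) (avoids u)
  ... | no _  | no _  | no _  | no _  = f-inj eq

module _ {G : EdgeOrderedGraph k l} {H : EdgeOrderedGraph n m} (E : Embedding G H)
         (e : Edge n) (e∉ : e ∉ edges H) (p : Fin (suc m)) (g : Fin l) where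
  open Embedding E

  -- As `g` is isolated, the other edges of `G` avoid the redirected vertices and keep their images
  -- in `H`. The bound in `above` is weak because an old edge at position `p` or later moves up by
  -- one.
  addEdge-copyUsing : Isolated G g → (∀ u → ¬ φ u ∈ₑ e) →
                      (∀ i → i Fin.< g → ψ i Fin.< p) → (∀ i → g Fin.< i → p Fin.≤ ψ i) →
                      CopyUsing G (addEdge H e e∉ p) p
  addEdge-copyUsing isolated avoids below above =
    subst (CopyUsing G (addEdge H e e∉ p)) ψ′-g (embedding⇒copyUsing E′ g)
    where
    φ′ : Fin k → Fin n
    φ′ = redirect φ (edge G g) e

    ψ′ : Fin l → Fin (suc m)
    ψ′ i with i ≟ g
    ... | yes _ = p
    ... | no  _ = punchIn p (ψ i)

    ψ′-g : ψ′ g ≡ p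
    ψ′-g with g ≟ g
    ... | yes _ = refl
    ... | no ≢  = contradiction refl ≢

    ψ′-mono : ∀ {i j} → i Fin.< j → ψ′ i Fin.< ψ′ j
    ψ′-mono {i} {j} i<j with i ≟ g | j ≟ g
    ... | yes refl | yes refl = contradiction i<j (ℕ.<-irrefl refl)
    ... | yes refl | no _     = punchIn-> p (ψ j) (above j i<j)
    ... | no _     | yes refl = punchIn-< p (ψ i) (below i i<j)
    ... | no _     | no _     = punchIn-mono-< p (ψ-mono i<j)

    lo-≡′ : ∀ i → lo (edge (addEdge H e e∉ p) (ψ′ i)) ≡ φ′ (lo (edge G i))
    lo-≡′ i with i ≟ g
    ... | yes refl rewrite insertAt-lookup (edges H) p e = sym (redirect-lo φ (edge G i) e)
    ... | no i≢g rewrite insertAt-punchIn (edges H) p e (ψ i) =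
      trans (lo-≡ i) (sym (redirect-∉ φ (edge G g) e λ ∈g → isolated i i≢g _ ∈g (inj₁ refl)))

    hi-≡′ : ∀ i → hi (edge (addEdge H e e∉ p) (ψ′ i)) ≡ φ′ (hi (edge G i))
    hi-≡′ i with i ≟ g
    ... | yes refl rewrite insertAt-lookup (edges H) p e = sym (redirect-hi φ (edge G i) e)
    ... | no i≢g rewrite insertAt-punchIn (edges H) p e (ψ i) =
      trans (hi-≡ i) (sym (redirect-∉ φ (edge G g) e λ ∈g → isolated i i≢g _ ∈g (inj₂ refl)))

    E′ : Embedding G (addEdge H e e∉ p)
    E′ = record
      { φ           = φ′
      ; ψ           = ψ′
      ; φ-injective = redirect-injective φ (edge G g) e φ-injective avoids
      ; ψ-mono      = ψ′-mono
      ; lo-≡        = lo-≡′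
      ; hi-≡        = hi-≡′
      }

-- Disjoint copies, consecutive in the edge order.

module DisjointCopies (G : EdgeOrderedGraph k l) {c : ℕ} (large : c * k ℕ.≤ n) where

  -- `combine` makes the copy number the leading digit. Within a copy the vertex order is kept, so
  -- `edgeAt` preserves `lo` and `hi`; used on edge positions, it makes each copy a block of
  -- consecutive edges.
  vertex : Fin c → Fin k → Fin n
  vertex b u = inject≤ (combine b u) large

  vertex-injective : ∀ {b d u v} → vertex b u ≡ vertex d v → b ≡ d × u ≡ v
  vertex-injective eq = combine-injective _ _ _ _ (inject≤-injective large large _ _ eq)

  edgeAt : Fin c → Fin l → Edge n
  edgeAt b i = mkEdge (vertex b (lo (edge G i))) (vertex b (hi (edge G i)))
    (subst₂ ℕ._<_ (sym (toℕ-inject≤ _ large)) (sym (toℕ-inject≤ _ large))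
      (combine-monoʳ-< b (lo<hi (edge G i))))

  edgeAt-injective : ∀ {b d i j} → edgeAt b i ≡ edgeAt d j → b ≡ d × i ≡ j
  edgeAt-injective {i = i} {j} eq =
    proj₁ (vertex-injective (cong lo eq)) ,
    lookup-injective (unique G) i j
      (Edge-≡ (proj₂ (vertex-injective (cong lo eq))) (proj₂ (vertex-injective (cong hi eq))))

  copies : EdgeOrderedGraph n (c * l)
  copies = mkGraph (tabulate edgeOf) (tabulate⁺ edgeOf-injective)
    where
    edgeOf : Fin (c * l) → Edge n
    edgeOf j = edgeAt (proj₁ (remQuot l j)) (proj₂ (remQuot {c} l j))

    edgeOf-injective : ∀ {i j} → edgeOf i ≡ edgeOf j → i ≡ j
    edgeOf-injective {i} {j} eq with b≡ , i≡ ← edgeAt-injective eq =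
      trans (sym (combine-remQuot {c} l i)) (trans (cong₂ combine b≡ i≡) (combine-remQuot {c} l j))

  edge-copies : ∀ b i → edge copies (combine b i) ≡ edgeAt b i
  edge-copies b i = trans (lookup∘tabulate _ (combine b i))
    (cong (λ (d , j) → edgeAt d j) (remQuot-combine b i))

  embedding : Fin c → Embedding G copies
  embedding b = record
    { φ           = vertex b
    ; ψ           = combine b
    ; φ-injective = proj₂ ∘ vertex-injective
    ; ψ-mono      = combine-monoʳ-< b
    ; lo-≡        = λ i → cong lo (edge-copies b i)
    ; hi-≡        = λ i → cong hi (edge-copies b i)
    }

  module _ (e : Edge n) (h : Fin 3 → Fin c) (h-injective : Injective _≡_ _≡_ h) where

    private
      Touched : Fin 3 → Set
      Touched b = ∃₂ λ s u → vertex (h b) u ≡ endpoint e s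

      touched? : ∀ b → Dec (Touched b)
      touched? b = any? λ s → any? λ u → vertex (h b) u ≟ endpoint e s

      ¬all-touched : ¬ (∀ b → Touched b)
      ¬all-touched touched =
        -- Three touched copies share the two ends of `e`, so two of them contain the same end,
        -- against disjointness.
        let b , d , b<d , same = pigeonhole (s<s (s<s z<s)) (proj₁ ∘ touched)
            _ , _ , b≡ = touched b
            _ , _ , d≡ = touched d
        in <⇒≢ b<d (h-injective (proj₁ (vertex-injective
             (trans b≡ (trans (cong (endpoint e) same) (sym d≡))))))

    avoiding : ∃[ b ] (∀ u → ¬ vertex (h b) u ∈ₑ e)
    avoiding =
      let b , ¬touched = ¬∀⟶∃¬ 3 Touched touched? ¬all-touched
      in b , λ u u∈ → let s , eq = ∈ₑ⇒endpoint u∈ in ¬touched (s , u , sym eq)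

copies-semisaturated : (G : EdgeOrderedGraph k l) {e₀ eₘₐₓ : Fin l} → Minimal G e₀ → Maximal G eₘₐₓ →
                       Isolated G e₀ → Isolated G eₘₐₓ → (large : 7 * k ℕ.≤ n) →
                       Semisaturated G (DisjointCopies.copies G {c = 7} large)
-- The edge e meets at most two copies, so it misses one of the first three and one of
-- the last three; the pivot in the fourth copy decides which of the two is used.
copies-semisaturated {l = l} G {e₀} {eₘₐₓ} min max isolated₀ isolatedₘₐₓ large e e∉ p =
  [ as-minimal , as-maximal ]′ (ℕ.≤-<-connex (toℕ p) (toℕ pivot))
  where
  open DisjointCopies G {c = 7} large

  pivot : Fin (7 * l)
  -- Counting from zero, copies 0 to 2 lie before the pivot and copies 4 to 6 after it; `e₀` just
  -- picks some edge of copy 3.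
  pivot = combine {7} (# 3) e₀

  as-minimal : p Fin.≤ pivot → CopyUsing G (addEdge copies e e∉ p) p
  as-minimal p≤pivot =
    let b , avoids = avoiding e (4 ↑ʳ_) (↑ʳ-injective 4 _ _)
    in addEdge-copyUsing (embedding (4 ↑ʳ b)) e e∉ p e₀ isolated₀ avoids
         -- No edge of `G` precedes `e₀`, and every edge of the chosen copy comes after the pivot,
         -- hence at position `p` or later.
         (λ i i<e₀ → contradiction (min i) (ℕ.<⇒≱ i<e₀))
         (λ i _ → ℕ.≤-trans p≤pivot (ℕ.<⇒≤ (combine-monoˡ-< e₀ i (3<4+ b))))
    where
    3<4+ : (b : Fin 3) → 3 ℕ.< toℕ (4 ↑ʳ b)
    3<4+ b = s<s (s<s (s<s z<s))

  as-maximal : pivot Fin.< p → CopyUsing G (addEdge copies e e∉ p) p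
  as-maximal pivot<p =
    let b , avoids = avoiding e (_↑ˡ 4) (↑ˡ-injective 4 _ _)
    in addEdge-copyUsing (embedding (b ↑ˡ 4)) e e∉ p eₘₐₓ isolatedₘₐₓ avoids
         (λ i _ → ℕ.<-trans (combine-monoˡ-< i e₀ (<3 b)) pivot<p)
         (λ i eₘₐₓ<i → contradiction (max i) (ℕ.<⇒≱ eₘₐₓ<i))
    where
    <3 : (b : Fin 3) → toℕ (b ↑ˡ 4) ℕ.< 3
    <3 b = subst (ℕ._< 3) (sym (toℕ-↑ˡ b 4)) (toℕ<n b)

theorem10 : ∀ {k l : ℕ} (G : EdgeOrderedGraph k l) (e₀ eₘₐₓ : Fin l) →
    Minimal G e₀ → Maximal G eₘₐₓ →
    (Isolated G e₀ × Isolated G eₘₐₓ → (λ n → ssatₑ n G) ∈O[ (λ n → 1) ])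
    × (¬ (Isolated G e₀ × Isolated G eₘₐₓ) → (λ n → ssatₑ n G) ∈Ω[ (λ n → n) ])
theorem10 {k} {l} G e₀ eₘₐₓ min max = constant , linear
  where
  constant : Isolated G e₀ × Isolated G eₘₐₓ → (λ n → ssatₑ n G) ∈O[ (λ n → 1) ]
  -- Seven copies have 7l edges in total and fit once n is at least 7k.
  constant (isolated₀ , isolatedₘₐₓ) = 7 * l , 7 * k , λ n large →
    subst (ssatₑ n G ℕ.≤_) (sym (ℕ.*-identityʳ (7 * l)))
      (proj₂ (ssatₑ-isMinimum G n) (7 * l)
        (DisjointCopies.copies G {c = 7} large , copies-semisaturated G min max isolated₀ isolatedₘₐₓ large))

  n≤1+2m⇒n≤3m : ∀ {n} m → n ℕ.≥ 2 → n ℕ.≤ suc (2 * m) → n ℕ.≤ 3 * m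
  n≤1+2m⇒n≤3m ℕ.zero n≥2 n≤ = contradiction (ℕ.≤-trans n≥2 n≤) λ { (s≤s ()) }
  n≤1+2m⇒n≤3m (suc m) _ n≤ = ℕ.≤-trans n≤ (ℕ.+-monoˡ-≤ (2 * suc m) {1} (s≤s ℕ.z≤n))

  linear : ¬ (Isolated G e₀ × Isolated G eₘₐₓ) → (λ n → ssatₑ n G) ∈Ω[ (λ n → n) ]
  -- The first 2 encodes the factor `suc 2`, that is 3. The threshold 2 excludes m = 0, so that 1 +
  -- 2m is at most 3m.
  linear ¬isolated = 2 , 2 , λ n n≥2 →
    let H , saturated = proj₁ (ssatₑ-isMinimum G n)
    in n≤1+2m⇒n≤3m (ssatₑ n G) n≥2 (semisaturated⇒large min max ¬isolated H saturated)
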